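{- Let $A$ be an irreducible $N\times N$ max-plus matrix and let $G=G(A)$. Then $$\mu(A)\le(\Delta(G)-\delta(G))\cdot(N-1)+(\varrho(G)-\delta(G))\cdot\big(2(N-1)+ep(G)\big).$$
   Context: Let $\mathbb{R}_{\max}=\mathbb{R}\cup\{ -\infty\}$; a max-plus matrix has entries in $\mathbb{R}_{\max}$, and $(A\otimes B)_{i,j}=\max_k(A_{i,k}+B_{k,j})$; $A^{\otimes n}$ is the $n$-th power. Graphs are finite, directed, with loops allowed, nonempty node set and at most one edge per ordered pair; a graph is nontrivial if it has an edge. A path is a finite sequence of consecutive edges (repetitions allowed, empty path at a node allowed); its length $\ell$ is its number of edges. A path is closed if start = end; elementary if the start nodes of its edges are pairwise distinct; simple if it is empty, or elementary and non-closed. $cd(G)$ is the maximum length of simple paths in $G$. For a nontrivial strongly connected graph $H$, $c(H)$ is the gcd of the lengths of its nonempty closed paths, and $ep(H)$ is the smallest integer $k$ such that for every node $i$ of $H$ and every integer $n\ge k$ that is a multiple of $c(H)$ there is a closed path in $H$ of length $n$ starting at $i$. $G(A)$ has nodes $1,\dots,N$, an edge $(i,j)$ iff $A_{i,j}\neq-\infty$, and edge weight $A_{i,j}$. $A$ is irreducible if $G(A)$ is strongly connected and nontrivial. $\Delta(G)$ and $\delta(G)$ are the maximum and minimum edge weights. The rate is $\varrho(G)=\sup w_*(\gamma)/\ell(\gamma)$ over nonempty closed paths $\gamma$, $w_*(\gamma)$ being the sum of the edge weights. A nonempty closed path is critical if it attains $\varrho(G)$; an edge is critical if it lies on a critical closed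 path; the critical subgraph $G_c$ consists of the critical edges and their incident nodes. With maxima over the strongly connected components $H$ of $G_c$, let $$B_{m/s}(G)=2\,cd(G)+ep(G)+\max_{H}c(H)+\max_{H}ep(H)-1,$$ $$\mu(A)=\sup\big\{A^{\otimes n}_{i,k}-A^{\otimes n}_{i,j}\ \mid\ i,j,k\in\{1,\dots,N\},\ n\ge B_{m/s}(G),\ A^{\otimes n}_{i,j}\ne-\infty\big\}.$$ -}

module Defs where

open import Level using (Level; _⊔_; suc)
open import Algebra.Bundles using (CommutativeRing)
open import Algebra.Core using (Op₁)
open import Algebra.Definitions using (Congruent₁)
open import Data.Bool.Base using (if_then_else_)
open import Data.Empty using (⊥-elim)
open import Data.Fin.Base using (Fin)
import Data.Fin.Properties as Fin
open import Data.Integer.Base as ℤ using (ℤ; +_; -[1+_])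
open import Data.Integer.Divisibility using () renaming (_∣_ to _∣ℤ_)
open import Data.List.Base as List using (List; []; _∷_)
open import Data.List.Membership.Propositional using (_∈_)
open import Data.List.Relation.Unary.Unique.Propositional using (Unique)
open import Data.Nat.Base as ℕ using (ℕ)
open import Data.Nat.Divisibility using (_∣_)
open import Data.Product.Base using (∃; ∃-syntax; _×_; _,_; proj₁)
open import Data.Sum.Base using (_⊎_; inj₁; inj₂)
open import Data.Unit.Polymorphic.Base using (⊤; tt)
open import Data.Vec.Functional using (foldr)
open import Function.Base using (flip)
open import Relation.Binary.Bundles using (DecTotalOrder)
open import Relation.Binary.Core using (Rel)
open import Relation.Binary.PropositionalEquality.Core using (_≡_; _≢_; refl)
open import Relation.Binary.Structures using (IsDecTotalOrder)
open import Relation.Nullary.Decidable.Core using (does)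
open import Relation.Nullary.Negation using (¬_)
open import Relation.Nullary.Construct.Add.Infimum using (_₋; ⊥₋; [_])
open import Relation.Nullary.Construct.Add.Extrema using (_±)
import Relation.Nullary.Construct.Add.Supremum as Supremum
import Relation.Binary.Construct.Add.Extrema.NonStrict as Extrema
open import Relation.Unary using (Pred; Satisfiable)
import Algebra.Construct.NaturalChoice.Max as NaturalMax
import Algebra.Definitions.RawMonoid as RawMonoid

private
  variable
    a ℓ p : Level
    N : ℕ

-- A quantity specified as a supremum, maximum, minimum or gcd is represented by
-- the predicate that determines it, rather than by a total function: choosing
-- its value is not constructive in general.
module _ {X : Set a} (_≤_ : Rel X ℓ) where

  UpperBound : Pred X p → Pred X (a ⊔ ℓ ⊔ p)
  UpperBound S b = ∀ {x} → S x → x ≤ b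

  IsMaximum : Pred X p → Pred X (a ⊔ ℓ ⊔ p)
  IsMaximum S m = S m × UpperBound S m

  IsSupremum : Pred X p → Pred X (a ⊔ ℓ ⊔ p)
  IsSupremum S s = UpperBound S s × (∀ b → UpperBound S b → s ≤ b)

IsMinimum : {X : Set a} (_≤_ : Rel X ℓ) → Pred X p → Pred X (a ⊔ ℓ ⊔ p)
IsMinimum _≤_ = IsMaximum (flip _≤_)

IsGCD : Pred ℕ p → ℕ → Set p
IsGCD S d = (∀ {n} → S n → d ∣ n) × (∀ k → (∀ {n} → S n → k ∣ n) → k ∣ d)

-- The axioms of a Dedekind-complete ordered field, which determine the real
-- numbers up to isomorphism.
record RealNumbers c ℓ₁ ℓ₂ : Set (suc (c ⊔ ℓ₁ ⊔ ℓ₂)) where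
  infix  8 _⁻¹
  infix  4 _≤_

  field
    commutativeRing : CommutativeRing c ℓ₁

  open CommutativeRing commutativeRing public

  field
    -- The value of 0# ⁻¹ is unconstrained.
    _⁻¹             : Op₁ Carrier
    ⁻¹-cong         : Congruent₁ _≈_ _⁻¹
    ⁻¹-inverseʳ     : ∀ {x} → ¬ (x ≈ 0#) → x * x ⁻¹ ≈ 1#
    0≉1             : ¬ (0# ≈ 1#)
    _≤_             : Rel Carrier ℓ₂
    isDecTotalOrder : IsDecTotalOrder _≈_ _≤_
    +-monoʳ-≤       : ∀ x {y z} → y ≤ z → x + y ≤ x + z
    *-nonNegative   : ∀ {x y} → 0# ≤ x → 0# ≤ y → 0# ≤ x * y
    complete        : (S : Pred Carrier (c ⊔ ℓ₁ ⊔ ℓ₂)) → Satisfiable S →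
                      ∃ (UpperBound _≤_ S) → ∃ (IsSupremum _≤_ S)

  decTotalOrder : DecTotalOrder c ℓ₁ ℓ₂
  decTotalOrder = record { isDecTotalOrder = isDecTotalOrder }

  open RawMonoid +-rawMonoid using () renaming (_×_ to _·_)

  fromℕ : ℕ → Carrier
  fromℕ n = n · 1#

  fromℤ : ℤ → Carrier
  fromℤ (+ n)    = fromℕ n
  fromℤ -[1+ n ] = - fromℕ (ℕ.suc n)

-- A graph whose nodes form a subset of Fin N, so that subgraphs of a
-- graph live on the same ambient set.
record Graph (N : ℕ) ℓ : Set (suc ℓ) where
  field
    Node     : Pred (Fin N) ℓ
    Edge     : Rel (Fin N) ℓ
    incident : ∀ {i j} → Edge i j → Node i × Node j

module _ (G : Graph N ℓ) where
  open Graph G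

  infixr 5 _∷_

  data Path : Rel (Fin N) ℓ where
    []  : ∀ {i} → Node i → Path i i
    _∷_ : ∀ {i j k} → Edge i j → Path j k → Path i k

module _ {G : Graph N ℓ} where
  open Graph G

  edges : ∀ {i j} → Path G i j → List (Fin N × Fin N)
  edges ([] _)            = []
  edges (_∷_ {i} {j} _ π) = (i , j) ∷ edges π

  length : ∀ {i j} → Path G i j → ℕ
  length π = List.length (edges π)

  Empty : ∀ {i j} → Path G i j → Set
  Empty π = length π ≡ 0

  NonEmpty : ∀ {i j} → Path G i j → Set
  NonEmpty π = ¬ Empty π

  Elementary : ∀ {i j} → Path G i j → Set
  Elementary π = Unique (List.map proj₁ (edges π))

  Simple : ∀ {i j} → Path G i j → Set
  Simple {i} {j} π = Empty π ⊎ (Elementary π × i ≢ j)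

module _ (G : Graph N ℓ) where
  open Graph G

  Nontrivial : Set ℓ
  Nontrivial = ∃[ i ] ∃[ j ] Edge i j

  StronglyConnected : Set ℓ
  StronglyConnected = ∀ {i j} → Node i → Node j → Path G i j

  IsCabDriverDiameter : Pred ℕ ℓ
  IsCabDriverDiameter = IsMaximum ℕ._≤_ λ n →
    ∃[ i ] ∃[ j ] ∃[ π ] Simple {G = G} {i} {j} π × n ≡ length π

  IsCyclicity : Pred ℕ ℓ
  IsCyclicity = IsGCD λ n → ∃[ i ] ∃[ γ ] NonEmpty {G = G} {i} {i} γ × n ≡ length γ

  -- Negative integers are not lengths, so the least k can be negative: it is
  -- 1 - c when G is an elementary cycle of length c.
  IsExplorationPenalty : Pred ℤ ℓ
  IsExplorationPenalty e = ∃[ c ] IsCyclicity c ×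
    IsMinimum ℤ._≤_
      (λ k → ∀ {i} → Node i → ∀ n → k ℤ.≤ n → (+ c) ∣ℤ n →
             ∃[ γ ] n ≡ + length {G = G} {i} {i} γ)
      e

  -- The strongly connected component containing the node r.
  component : Fin N → Graph N ℓ
  component r = record
    { Node     = _∈component
    ; Edge     = λ i j → Edge i j × i ∈component × j ∈component
    ; incident = λ (_ , i∈ , j∈) → i∈ , j∈
    }
    where
    _∈component : Pred (Fin N) ℓ
    i ∈component = Path G r i × Path G i r

module MaxPlus {c ℓ₁ ℓ₂} (ℝ : RealNumbers c ℓ₁ ℓ₂) where
  open RealNumbers ℝ hiding (refl)
  open NaturalMax (DecTotalOrder.totalOrder decTotalOrder) using () renaming (_⊔_ to max)
  open Extrema _≤_ public using (_≤±_)

  ℝmax : Set c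
  ℝmax = Carrier ₋

  infixl 6 _⊕_ _⊖_
  infixl 7 _⊙_ _⊗_
  infixr 8 _^⊗_

  _⊕_ : ℝmax → ℝmax → ℝmax
  ⊥₋    ⊕ y     = y
  [ x ] ⊕ ⊥₋    = [ x ]
  [ x ] ⊕ [ y ] = [ max x y ]

  _⊙_ : ℝmax → ℝmax → ℝmax
  ⊥₋    ⊙ _     = ⊥₋
  [ _ ] ⊙ ⊥₋    = ⊥₋
  [ x ] ⊙ [ y ] = [ x + y ]

  finite : ∀ {x : ℝmax} → x ≢ ⊥₋ → Carrier
  finite {⊥₋}    x≢⊥ = ⊥-elim (x≢⊥ refl)
  finite {[ x ]} _   = x

  _⊖_ : ℝmax → Carrier → ℝmax
  ⊥₋    ⊖ _ = ⊥₋
  [ x ] ⊖ y = [ x - y ]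

  Matrix : ℕ → Set c
  Matrix N = Fin N → Fin N → ℝmax

  _⊗_ : Matrix N → Matrix N → Matrix N
  (A ⊗ B) i j = foldr _⊕_ ⊥₋ (λ k → A i k ⊙ B k j)

  identity : Matrix N
  identity i j = if does (i Fin.≟ j) then [ 0# ] else ⊥₋

  _^⊗_ : Matrix N → ℕ → Matrix N
  A ^⊗ ℕ.zero  = identity
  A ^⊗ ℕ.suc n = A ⊗ A ^⊗ n

  graph : Matrix N → Graph N c
  graph A = record
    { Node     = λ _ → ⊤
    ; Edge     = λ i j → A i j ≢ ⊥₋
    ; incident = λ _ → tt , tt
    }

  module _ (A : Matrix N) where
    private
      G : Graph N c
      G = graph A
    open Graph G

    Irreducible : Set c
    Irreducible = StronglyConnected G × Nontrivial G

    EdgeWeight : Pred Carrier c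
    EdgeWeight w = ∃[ i ] ∃[ j ] ∃[ e ] w ≡ finite {A i j} e

    IsMaxWeight : Pred Carrier (c ⊔ ℓ₂)
    IsMaxWeight = IsMaximum _≤_ EdgeWeight

    IsMinWeight : Pred Carrier (c ⊔ ℓ₂)
    IsMinWeight = IsMinimum _≤_ EdgeWeight

    weight : ∀ {i j} → Path G i j → Carrier
    weight ([] _)  = 0#
    weight (e ∷ π) = finite e + weight π

    mean : ∀ {i j} → Path G i j → Carrier
    mean π = weight π * fromℕ (length π) ⁻¹

    IsRate : Pred Carrier (c ⊔ ℓ₂)
    IsRate = IsSupremum _≤_ λ x → ∃[ i ] ∃[ γ ] NonEmpty {i = i} {j = i} γ × x ≡ mean γ

    Critical : ∀ {i} → Path G i i → Set (c ⊔ ℓ₂)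
    Critical γ = NonEmpty γ × IsRate (mean γ)

    CriticalEdge : Rel (Fin N) (c ⊔ ℓ₂)
    CriticalEdge u v = ∃[ i ] ∃[ γ ] Critical {i} γ × (u , v) ∈ edges γ

    criticalSubgraph : Graph N (c ⊔ ℓ₂)
    criticalSubgraph = record
      { Node     = λ u → ∃[ v ] (CriticalEdge u v ⊎ CriticalEdge v u)
      ; Edge     = CriticalEdge
      ; incident = λ {u} {v} uv → (v , inj₁ uv) , (u , inj₂ uv)
      }

    CriticalComponent : Pred (Graph N (c ⊔ ℓ₂)) (suc (c ⊔ ℓ₂))
    CriticalComponent H =
      ∃[ r ] Graph.Node criticalSubgraph r × H ≡ component criticalSubgraph r

    IsBms : Pred ℤ (suc (c ⊔ ℓ₂))
    IsBms B =
      ∃[ cd ] ∃[ ep ] ∃[ maxC ] ∃[ maxEp ]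
        IsCabDriverDiameter G cd × IsExplorationPenalty G ep ×
        IsMaximum ℕ._≤_ (λ m → ∃[ H ] CriticalComponent H × IsCyclicity H m) maxC ×
        IsMaximum ℤ._≤_ (λ m → ∃[ H ] CriticalComponent H × IsExplorationPenalty H m) maxEp ×
        B ≡ + 2 ℤ.* + cd ℤ.+ ep ℤ.+ + maxC ℤ.+ maxEp ℤ.- + 1

    -- The differences lie in ℝmax; their supremum is taken in the extended
    -- reals.
    Isμ : Pred (Carrier ±) (suc (c ⊔ ℓ₂))
    Isμ μ = ∃[ B ] IsBms B ×
      IsSupremum _≤±_
        (λ x → ∃[ i ] ∃[ j ] ∃[ k ] ∃[ n ] B ℤ.≤ + n ×
               (∃[ f ] x ≡ Supremum.[ (A ^⊗ n) i k ⊖ finite {(A ^⊗ n) i j} f ]))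
        μ

{-# OPTIONS --safe #-}
module Submission where

-- Write p = N - 1, and fix an index n at least B. It suffices to bound
-- A^n(i,k) - A^n(i,j) whenever A^n(i,j) is finite, and both entries are maximal
-- weights of paths of length n.
--
-- Upper bound. Deleting closed subpaths from a path of length n leaves a path
-- with distinct vertices, of some length l at most p. The deleted closed paths
-- have mean weight at most the rate, so the weight of the original is at most
-- Δ l + ϱ (n - l), hence at most Δ p + ϱ (n - p), since ϱ is at most Δ
-- (weight-upper).
--
-- Lower bound. Let H be a critical component whose exploration penalty is
-- maximal and let r be a node of it. Loop-free paths lead from i to r and from
-- r to j. Both have length at most p, and also at most cd(G), since a path with
-- distinct vertices is simple. The length m still missing is a multiple of
-- c(G), because a path of length n from i to j exists. Euclidean division by
-- c(H) writes m = t + s with ep(G) at most t, t less than ep(G) + c(H), and s a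
-- multiple of c(H) (split-multiple). As c(G) divides c(H), there is a closed
-- path of length t at r in G, and the assumption on n leaves s at least ep(H)
-- (remainder-≥), so there is a closed path of length s at r in H. It contributes
-- weight at least ϱ s (closed-critical); the edges of the three other parts weigh
-- at least δ each. There are at most M = 3 p + ep(G) of them because c(H) is at most N
-- (critical-cyclicity-bounded), so the path assembled from these four parts
-- weighs at least δ M + ϱ (n - M) (weight-lower, heavy-walk). This uses that ϱ is
-- at least δ.
--
-- Subtracting, the difference of the entries is at most
-- (Δ - ϱ) p + (ϱ - δ) M = (Δ - δ) p + (ϱ - δ) (2 p + ep(G)).
--
-- Inequalities are kept free of subtraction until the last step: a bound such
-- as w ≤ Δ p + ϱ (n - p) is stated as w + ϱ p ≤ Δ p + ϱ n.

import Algebra.Construct.NaturalChoice.Max as NaturalMax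
open import Data.Empty using (⊥; ⊥-elim)
open import Data.Fin.Base as Fin using (Fin)
import Data.Fin.Properties as Fin
open import Data.Integer.Base as ℤ using (ℤ; +_; -[1+_])
import Data.Integer.DivMod as ℤ
import Data.Integer.Properties as ℤ
import Data.Integer.Divisibility.Signed as Signed
import Data.Integer.Tactic.RingSolver as ℤSolver
open import Data.List.Base as List using (List; []; _∷_; _∷ʳ_)
import Data.List.Membership.DecPropositional as DecMembership
open import Data.List.Membership.Propositional using (_∈_)
open import Data.List.Membership.Propositional.Properties using (∈-lookup)
open import Data.List.Relation.Unary.All as All using (All; []; _∷_)
import Data.List.Relation.Unary.All.Properties as All
open import Data.List.Relation.Unary.Any using (here; there)
open import Data.List.Relation.Unary.AllPairs using ([]; _∷_)
open import Data.List.Relation.Unary.Unique.Propositional using (Unique)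
open import Data.Nat.Base as ℕ using (ℕ; zero; suc)
import Data.Nat.Properties as ℕ
open import Data.Nat.Divisibility as ℕ∣ using (_∣_)
open import Data.Product.Base using (∃; ∃-syntax; _×_; _,_; proj₁; proj₂)
open import Data.Sum.Base using (_⊎_; inj₁; inj₂)
open import Data.Vec.Functional using (foldr)
open import Function.Base using (_∘_)
open import Function.Definitions using (Injective)
open import Level using (Level)
open import Relation.Binary.Bundles using (DecTotalOrder)
open import Relation.Binary.PropositionalEquality as ≡
  using (_≡_; _≢_; refl; sym; trans; cong; cong₂; subst; subst₂)
open import Relation.Nullary.Construct.Add.Extrema using (_±; [_])
import Relation.Nullary.Construct.Add.Infimum as Infimum
import Relation.Nullary.Construct.Add.Supremum as Supremum
open import Relation.Nullary.Construct.Add.Infimum using (⊥₋)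
import Relation.Binary.Construct.Add.Infimum.NonStrict as Infimum≤
import Relation.Binary.Construct.Add.Supremum.NonStrict as Supremum≤
open import Relation.Nullary.Decidable.Core using (yes; no)
open import Defs

private
  variable
    ℓ : Level
    N : ℕ
    i j k : Fin N

-- Lists without repetitions

lookup-injective : {X : Set ℓ} {xs : List X} → Unique xs → Injective _≡_ _≡_ (List.lookup xs)
lookup-injective (_    ∷ _)  {Fin.zero}  {Fin.zero}  _  = refl
lookup-injective (x∉xs ∷ _)  {Fin.zero}  {Fin.suc q} eq = ⊥-elim (All.lookup x∉xs (∈-lookup q) eq)
lookup-injective (x∉xs ∷ _)  {Fin.suc p} {Fin.zero}  eq = ⊥-elim (All.lookup x∉xs (∈-lookup p) (sym eq))
lookup-injective (_    ∷ xs) {Fin.suc p} {Fin.suc q} eq = cong Fin.suc (lookup-injective xs eq)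

∷ʳ-unique⁻ : {X : Set ℓ} (xs : List X) {y : X} → Unique (xs ∷ʳ y) → Unique xs
∷ʳ-unique⁻ []       _         = []
∷ʳ-unique⁻ (x ∷ xs) (x∉ ∷ u) = proj₁ (All.∷ʳ⁻ x∉) ∷ ∷ʳ-unique⁻ xs u

-- Paths, loop erasure and cyclicity in a graph

module _ {G : Graph N ℓ} where
  open Graph G

  infixr 5 _++_

  _++_ : Path G i j → Path G j k → Path G i k
  [] _    ++ σ = σ
  (e ∷ π) ++ σ = e ∷ (π ++ σ)

  length-++ : (π : Path G i j) (σ : Path G j k) → length (π ++ σ) ≡ length π ℕ.+ length σ
  length-++ ([] _)  σ = refl
  length-++ (e ∷ π) σ = cong suc (length-++ π σ)

  source : Path G i j → Node i
  source ([] i∈)  = i∈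
  source (e ∷ _) = proj₁ (incident e)

  target : Path G i j → Node j
  target ([] j∈)  = j∈
  target (_ ∷ π) = target π

  -- All nodes visited, including the last one; edges only records the start nodes.
  vertices : Path G i j → List (Fin N)
  vertices ([] {i} _)      = i ∷ []
  vertices (_∷_ {i} _ π) = i ∷ vertices π

  length-vertices : (π : Path G i j) → List.length (vertices π) ≡ suc (length π)
  length-vertices ([] _)  = refl
  length-vertices (e ∷ π) = cong suc (length-vertices π)

  vertices-∷ʳ : (π : Path G i j) → vertices π ≡ List.map proj₁ (edges π) ∷ʳ j
  vertices-∷ʳ ([] _)  = refl
  vertices-∷ʳ (e ∷ π) = cong (_ ∷_) (vertices-∷ʳ π)

  target∈vertices : (π : Path G i j) → j ∈ vertices π
  target∈vertices ([] _)  = here refl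
  target∈vertices (e ∷ π) = there (target∈vertices π)

  edge-source∈vertices : ∀ {u v} (π : Path G i j) → (u , v) ∈ edges π → u ∈ vertices π
  edge-source∈vertices (e ∷ π) (here refl) = here refl
  edge-source∈vertices (e ∷ π) (there uv)  = there (edge-source∈vertices π uv)

  edge-target∈vertices : ∀ {u v} (π : Path G i j) → (u , v) ∈ edges π → v ∈ vertices π
  edge-target∈vertices (e ∷ ([] _))  (here refl) = there (here refl)
  edge-target∈vertices (e ∷ (f ∷ π)) (here refl) = there (here refl)
  edge-target∈vertices (e ∷ π)       (there uv)  = there (edge-target∈vertices π uv)

  -- The part from v onwards inherits distinctness of the vertices.
  split-vertex : ∀ {v} (π : Path G i j) → v ∈ vertices π →
                 ∃ λ (α : Path G i v) → ∃ λ (β : Path G v j) →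
                   π ≡ α ++ β × (Unique (vertices π) → Unique (vertices β))
  split-vertex ([] i∈)  (here refl) = [] i∈ , [] i∈ , refl , λ u → u
  split-vertex (e ∷ π) (here refl) = [] (source (e ∷ π)) , e ∷ π , refl , λ u → u
  split-vertex (e ∷ π) (there v∈) with α , β , refl , unique ← split-vertex π v∈
    = e ∷ α , β , refl , λ { (_ ∷ u) → unique u }

  split-edge : ∀ {u v} (π : Path G i j) → (u , v) ∈ edges π →
               ∃ λ (α : Path G i u) → ∃ λ (e : Edge u v) → ∃ λ (β : Path G v j) →
                 π ≡ α ++ e ∷ β
  split-edge (e ∷ π) (here refl) = [] (source (e ∷ π)) , e , π , refl
  split-edge (e ∷ π) (there uv) with α , f , β , refl ← split-edge π uv
    = e ∷ α , f , β , refl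

  rotate : ∀ {v} (γ : Path G i i) → v ∈ vertices γ → ∃ λ (γ′ : Path G v v) → length γ′ ≡ length γ
  rotate γ v∈ with α , β , refl , _ ← split-vertex γ v∈
    = β ++ α , trans (length-++ β α) (trans (ℕ.+-comm (length β) (length α)) (sym (length-++ α β)))

  -- π′ ≼ π: the path π′ arises from π by erasing some loops, processing the edges
  -- of π from last to first. In the case cut, prepending e to α ++ β returns to
  -- the node at which β starts, and the closed path e ∷ α is dropped.
  infix 4 _≼_

  data _≼_ : ∀ {i j} → Path G i j → Path G i j → Set ℓ where
    stop : {i∈ : Node i} → [] i∈ ≼ [] i∈
    keep : {e : Edge i j} {π π′ : Path G j k} → π′ ≼ π → e ∷ π′ ≼ e ∷ π
    cut  : {e : Edge i j} {π : Path G j k} (α : Path G j i) {β : Path G i k} →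
           α ++ β ≼ π → β ≼ e ∷ π

  erase-loops : (π : Path G i j) → ∃[ π′ ] π′ ≼ π × Unique (vertices π′)
  erase-loops ([] i∈) = [] i∈ , stop , [] ∷ []
  erase-loops (_∷_ {i} e π) with π′ , π′≼π , unique ← erase-loops π
                            with DecMembership._∈?_ Fin._≟_ i (vertices π′)
  ... | no  i∉ = e ∷ π′ , keep π′≼π , All.¬Any⇒All¬ _ i∉ ∷ unique
  ... | yes i∈ with α , β , refl , unique-β ← split-vertex π′ i∈
    = β , cut α π′≼π , unique-β unique

  Unique⇒length< : (π : Path G i j) → Unique (vertices π) → length π ℕ.< N
  Unique⇒length< π u =
    subst (ℕ._≤ N) (length-vertices π) (Fin.injective⇒≤ (lookup-injective u))

  -- The converse fails: only start nodes of edges are distinct in an elementary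
  -- path, so a simple path may end at one of its inner nodes.
  Unique⇒Simple : (π : Path G i j) → Unique (vertices π) → Simple π
  Unique⇒Simple ([] _)          _          = inj₁ refl
  Unique⇒Simple π@(_ ∷ π′) u@(i∉ ∷ _) = inj₂
    ( ∷ʳ-unique⁻ _ (subst Unique (vertices-∷ʳ π) u)
    , λ { refl → All.lookup i∉ (target∈vertices π′) refl } )

  -- The first edge is kept, and loops are erased from the rest.
  short-cycle : (γ : Path G i i) → NonEmpty γ → ∃ λ (γ′ : Path G i i) → NonEmpty γ′ × length γ′ ℕ.≤ N
  short-cycle ([] _)  nonEmpty = ⊥-elim (nonEmpty refl)
  short-cycle (e ∷ π) _ with π′ , _ , unique ← erase-loops π
    = e ∷ π′ , (λ ()) , Unique⇒length< π′ unique

  cyclicity∣length : ∀ {c} → IsCyclicity G c → (γ : Path G i i) → c ∣ length γ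
  cyclicity∣length {c = c} _       ([] _)  = c ℕ∣.∣0
  cyclicity∣length         (c∣ , _) (e ∷ π) = c∣ (_ , e ∷ π , (λ ()) , refl)

  -- Both paths are closed up by the same return path.
  lengths-congruent : ∀ {c} → IsCyclicity G c → StronglyConnected G →
                      (π σ : Path G i j) → (+ c) Signed.∣ (+ length π ℤ.- + length σ)
  lengths-congruent {c = c} isC connected π σ =
    subst (+ c Signed.∣_) difference
      (Signed.∣m∣n⇒∣m-n (divides (π ++ τ)) (divides (σ ++ τ)))
    where
    τ = connected (target π) (source π)
    divides : (γ : Path G i i) → (+ c) Signed.∣ (+ length γ)
    divides γ = Signed.∣ᵤ⇒∣ (cyclicity∣length isC γ)
    cancel : ∀ p s t → (p ℤ.+ t) ℤ.- (s ℤ.+ t) ≡ p ℤ.- s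
    cancel = ℤSolver.solve-∀
    difference : + length (π ++ τ) ℤ.- + length (σ ++ τ) ≡ + length π ℤ.- + length σ
    difference = trans
      (cong₂ (λ x y → + x ℤ.- + y) (length-++ π τ) (length-++ σ τ))
      (trans (cong₂ ℤ._-_ (ℤ.pos-+ (length π) _) (ℤ.pos-+ (length σ) _)) (cancel (+ length π) (+ length σ) (+ length τ)))

  -- Both values refer to the same cyclicity, since a gcd is unique up to mutual
  -- divisibility.
  penalty-unique : ∀ {e e′} → IsExplorationPenalty G e → IsExplorationPenalty G e′ → e ≡ e′
  penalty-unique (c , (c∣ , c-greatest) , closed , least)
                 (c′ , (c′∣ , c′-greatest) , closed′ , least′)
    with refl ← ℕ∣.∣-antisym (c′-greatest c c∣) (c-greatest c′ c′∣)
    = ℤ.≤-antisym (least closed′) (least′ closed)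

  -- A path lies in the component of r as soon as its first node is reachable from
  -- r and its last node leads back to r.
  into-component : ∀ {r} → Path G r i → (π : Path G i j) → Path G j r →
                   ∃ λ (π′ : Path (component G r) i j) → length π′ ≡ length π
  into-component ρ ([] _)  τ = [] (ρ , τ) , refl
  into-component ρ (e ∷ π) τ
    with π′ , eq ← into-component (ρ ++ e ∷ [] (proj₂ (incident e))) π τ
    = (e , (ρ , e ∷ π ++ τ) , (ρ ++ e ∷ [] (proj₂ (incident e)) , π ++ τ)) ∷ π′ , cong suc eq

  from-component : ∀ {r} (π : Path (component G r) i j) → ∃ λ (π′ : Path G i j) → length π′ ≡ length π
  from-component ([] (_ , τ)) = [] (source τ) , refl
  from-component ((e , _) ∷ π) with π′ , eq ← from-component π = e ∷ π′ , cong suc eq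

-- Integer arithmetic of path lengths

-- The number t is the representative of m modulo suc h in the interval from ep
-- to ep + h.
split-multiple : ∀ {g h} (m ep : ℤ) → (+ g) Signed.∣ m → g ∣ suc h →
  ∃[ t ] ∃[ s ] t ℤ.+ s ≡ m × ep ℤ.≤ t × t ℤ.≤ ep ℤ.+ + h ×
                (+ g) Signed.∣ t × (+ suc h) Signed.∣ s
split-multiple {g} {h} m ep g∣m g∣h =
  ep ℤ.+ + r , q ℤ.* + suc h , sum , ℤ.i≤i+j ep (+ r) ,
  ℤ.+-monoʳ-≤ ep (ℤ.+≤+ (ℕ.s≤s⁻¹ (ℤ.n%ℕd<d (m ℤ.- ep) (suc h)))) ,
  Signed.∣m+n∣n⇒∣m (subst (+ g Signed.∣_) (sym sum) g∣m)
    (Signed.∣-trans (Signed.∣ᵤ⇒∣ g∣h) h∣s) ,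
  h∣s
  where
  r = (m ℤ.- ep) ℤ.%ℕ suc h
  q = (m ℤ.- ep) ℤ./ℕ suc h
  h∣s : (+ suc h) Signed.∣ (q ℤ.* + suc h)
  h∣s = Signed.divides q refl
  cancel : ∀ m ep → ep ℤ.+ (m ℤ.- ep) ≡ m
  cancel = ℤSolver.solve-∀
  sum : (ep ℤ.+ + r) ℤ.+ q ℤ.* + suc h ≡ m
  sum = trans (ℤ.+-assoc ep (+ r) _)
    (trans (cong (ℤ._+_ ep) (sym (ℤ.a≡a%ℕn+[a/ℕn]*n (m ℤ.- ep) (suc h)))) (cancel m ep))

-- The lower bound on n leaves enough length for the closed path in the critical
-- component: here l is the length of the two connecting paths, t that of the
-- closed path in G, and s what remains.
remainder-≥ : ∀ {n l h} cd ep maxC maxEp t s → l ℕ.≤ cd ℕ.+ cd → t ℤ.≤ ep ℤ.+ + h →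
  suc h ℕ.≤ maxC → t ℤ.+ s ≡ + n ℤ.- + l →
  + 2 ℤ.* + cd ℤ.+ ep ℤ.+ + maxC ℤ.+ maxEp ℤ.- + 1 ℤ.≤ + n → maxEp ℤ.≤ s
remainder-≥ {n} {l} {h} cd ep maxC maxEp t s l≤ t≤ h<maxC t+s≡ B≤n =
  cancelʳ-≤ X (begin
    maxEp ℤ.+ X                                   ≡⟨ regroup₁ (+ cd) ep (+ maxC) maxEp ⟩
    (+ 2 ℤ.* + cd ℤ.+ ep ℤ.+ + maxC ℤ.+ maxEp ℤ.- + 1) ℤ.+ + 1
                                                  ≤⟨ ℤ.+-monoˡ-≤ (+ 1) B≤n ⟩
    + n ℤ.+ + 1                                   ≡⟨ regroup₂ (+ n) (+ l) ⟩
    (+ n ℤ.- + l) ℤ.+ (+ l ℤ.+ + 1)               ≡⟨ cong (ℤ._+ (+ l ℤ.+ + 1)) t+s≡ ⟨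
    (t ℤ.+ s) ℤ.+ (+ l ℤ.+ + 1)                   ≡⟨ regroup₃ t s (+ l) ⟩
    s ℤ.+ (+ l ℤ.+ (t ℤ.+ + 1))                   ≤⟨ ℤ.+-monoʳ-≤ s (ℤ.+-mono-≤ (ℤ.+≤+ l≤) t+1≤) ⟩
    s ℤ.+ X                                       ∎)
  where
  open ℤ.≤-Reasoning
  X = (+ cd ℤ.+ + cd) ℤ.+ (ep ℤ.+ + maxC)
  cancelʳ-≤ : ∀ z {x y} → x ℤ.+ z ℤ.≤ y ℤ.+ z → x ℤ.≤ y
  cancelʳ-≤ z {x} {y} le = subst₂ ℤ._≤_ (cancel x z) (cancel y z) (ℤ.+-monoˡ-≤ (ℤ.- z) le)
    where
    cancel : ∀ x z → (x ℤ.+ z) ℤ.- z ≡ x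
    cancel = ℤSolver.solve-∀
  t+1≤ : t ℤ.+ + 1 ℤ.≤ ep ℤ.+ + maxC
  t+1≤ = begin
    t ℤ.+ + 1              ≤⟨ ℤ.+-monoˡ-≤ (+ 1) t≤ ⟩
    (ep ℤ.+ + h) ℤ.+ + 1   ≡⟨ ℤ.+-assoc ep (+ h) (+ 1) ⟩
    ep ℤ.+ + (h ℕ.+ 1)     ≤⟨ ℤ.+-monoʳ-≤ ep (ℤ.+≤+ (subst (ℕ._≤ maxC) (ℕ.+-comm 1 h) h<maxC)) ⟩
    ep ℤ.+ + maxC          ∎
  regroup₁ : ∀ cd ep C E → E ℤ.+ ((cd ℤ.+ cd) ℤ.+ (ep ℤ.+ C)) ≡
             (+ 2 ℤ.* cd ℤ.+ ep ℤ.+ C ℤ.+ E ℤ.- + 1) ℤ.+ + 1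
  regroup₁ = ℤSolver.solve-∀
  regroup₂ : ∀ n l → n ℤ.+ + 1 ≡ (n ℤ.- l) ℤ.+ (l ℤ.+ + 1)
  regroup₂ = ℤSolver.solve-∀
  regroup₃ : ∀ t s l → (t ℤ.+ s) ℤ.+ (l ℤ.+ + 1) ≡ s ℤ.+ (l ℤ.+ (t ℤ.+ + 1))
  regroup₃ = ℤSolver.solve-∀

-- The four parts a, t, s, b of the assembled path have total length n.
lengths-add-up : ∀ a t s b {n} → + t ℤ.+ + s ≡ + n ℤ.- + (a ℕ.+ b) →
                 (a ℕ.+ t) ℕ.+ (s ℕ.+ b) ≡ n
lengths-add-up a t s b {n} t+s≡ = ℤ.+-injective (begin
  (+ a ℤ.+ + t) ℤ.+ (+ s ℤ.+ + b)           ≡⟨ regroup (+ a) (+ t) (+ s) (+ b) ⟩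
  (+ t ℤ.+ + s) ℤ.+ (+ a ℤ.+ + b)           ≡⟨ cong (ℤ._+ (+ a ℤ.+ + b)) t+s≡ ⟩
  (+ n ℤ.- (+ a ℤ.+ + b)) ℤ.+ (+ a ℤ.+ + b) ≡⟨ cancel (+ n) (+ a ℤ.+ + b) ⟩
  + n                                       ∎)
  where
  open ≡.≡-Reasoning
  regroup : ∀ a t s b → (a ℤ.+ t) ℤ.+ (s ℤ.+ b) ≡ (t ℤ.+ s) ℤ.+ (a ℤ.+ b)
  regroup = ℤSolver.solve-∀
  cancel : ∀ n x → (n ℤ.- x) ℤ.+ x ≡ n
  cancel = ℤSolver.solve-∀

-- The noncritical length a + t + b is bounded by 3 p + ep, which is therefore a
-- natural number M although ep may be negative.
ℕ-between : ∀ {a b h} p ep t → a ℕ.≤ p → b ℕ.≤ p → h ℕ.≤ p → + t ℤ.≤ ep ℤ.+ + h →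
  ∃[ M ] + M ≡ + p ℤ.+ (+ 2 ℤ.* + p ℤ.+ ep) × a ℕ.+ t ℕ.+ b ℕ.≤ M
ℕ-between {a} {b} {h} p ep t a≤p b≤p h≤p t≤ = natural (begin
  + (a ℕ.+ t ℕ.+ b)                ≤⟨ ℤ.+-mono-≤ (ℤ.+-mono-≤ (ℤ.+≤+ a≤p) t≤ep+p) (ℤ.+≤+ b≤p) ⟩
  (+ p ℤ.+ (ep ℤ.+ + p)) ℤ.+ + p   ≡⟨ regroup (+ p) ep ⟩
  + p ℤ.+ (+ 2 ℤ.* + p ℤ.+ ep)     ∎)
  where
  open ℤ.≤-Reasoning
  t≤ep+p : + t ℤ.≤ ep ℤ.+ + p
  t≤ep+p = ℤ.≤-trans t≤ (ℤ.+-monoʳ-≤ ep (ℤ.+≤+ h≤p))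
  regroup : ∀ p ep → (p ℤ.+ (ep ℤ.+ p)) ℤ.+ p ≡ p ℤ.+ (+ 2 ℤ.* p ℤ.+ ep)
  regroup = ℤSolver.solve-∀
  natural : ∀ {l z} → + l ℤ.≤ z → ∃[ M ] + M ≡ z × l ℕ.≤ M
  natural (ℤ.+≤+ l≤M) = _ , refl , l≤M

-- Ordered field arithmetic

module OrderedField {c ℓ₁ ℓ₂} (ℝ : RealNumbers c ℓ₁ ℓ₂) where
  open RealNumbers ℝ
    renaming (refl to ≈-refl; sym to ≈-sym; trans to ≈-trans; reflexive to ≈-reflexive)
  open DecTotalOrder decTotalOrder public
    using (poset; total; antisym) renaming (refl to ≤-refl; reflexive to ≤-reflexive; trans to ≤-trans)
  open import Relation.Binary.Reasoning.PartialOrder poset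
  open import Algebra.Solver.Ring.NaturalCoefficients.Default commutativeSemiring
    using (solve; _:=_; _:+_; _:*_; con)
  open import Algebra.Properties.Monoid.Mult +-monoid using (×-homo-+)
  open import Algebra.Properties.Ring ring using (-‿distribˡ-*; -‿involutive)

  +-mono-≤ : ∀ {x y u v} → x ≤ y → u ≤ v → x + u ≤ y + v
  +-mono-≤ {x} {y} {u} {v} x≤y u≤v = begin
    x + u ≤⟨ +-monoʳ-≤ x u≤v ⟩
    x + v ≈⟨ +-comm x v ⟩
    v + x ≤⟨ +-monoʳ-≤ v x≤y ⟩
    v + y ≈⟨ +-comm v y ⟩
    y + v ∎

  x+z-z≈x : ∀ x z → (x + z) - z ≈ x
  x+z-z≈x x z = ≈-trans (+-assoc x z (- z)) (≈-trans (+-congˡ (-‿inverseʳ z)) (+-identityʳ x))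

  x-z+z≈x : ∀ x z → (x - z) + z ≈ x
  x-z+z≈x x z = ≈-trans (+-assoc x (- z) z) (≈-trans (+-congˡ (-‿inverseˡ z)) (+-identityʳ x))

  +-cancelʳ-≤ : ∀ z {x y} → x + z ≤ y + z → x ≤ y
  +-cancelʳ-≤ z {x} {y} x+z≤y+z = begin
    x           ≈⟨ x+z-z≈x x z ⟨
    (x + z) - z ≤⟨ +-mono-≤ x+z≤y+z ≤-refl ⟩
    (y + z) - z ≈⟨ x+z-z≈x y z ⟩
    y           ∎

  *-monoˡ-≤ : ∀ {z x y} → 0# ≤ z → x ≤ y → x * z ≤ y * z
  *-monoˡ-≤ {z} {x} {y} 0≤z x≤y = begin
    x * z               ≈⟨ +-identityˡ _ ⟨
    0# + x * z          ≤⟨ +-mono-≤ (*-nonNegative 0≤y-x 0≤z) ≤-refl ⟩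
    (y - x) * z + x * z ≈⟨ distribʳ z (y - x) x ⟨
    ((y - x) + x) * z   ≈⟨ *-congʳ (x-z+z≈x y x) ⟩
    y * z               ∎
    where
    0≤y-x : 0# ≤ y - x
    0≤y-x = +-cancelʳ-≤ x (begin
      0# + x      ≈⟨ +-identityˡ x ⟩
      x           ≤⟨ x≤y ⟩
      y           ≈⟨ x-z+z≈x y x ⟨
      (y - x) + x ∎)

  0≤1 : 0# ≤ 1#
  0≤1 with total 0# 1#
  ... | inj₁ 0≤1 = 0≤1
  ... | inj₂ 1≤0 = begin
    0#          ≤⟨ *-nonNegative 0≤-1 0≤-1 ⟩
    - 1# * - 1# ≈⟨ -‿distribˡ-* 1# (- 1#) ⟨
    - (1# * - 1#) ≈⟨ -‿cong (*-identityˡ (- 1#)) ⟩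
    - - 1#      ≈⟨ -‿involutive 1# ⟩
    1#          ∎
    where
    0≤-1 : 0# ≤ - 1#
    0≤-1 = +-cancelʳ-≤ 1# (begin
      0# + 1#   ≈⟨ +-identityˡ 1# ⟩
      1#        ≤⟨ 1≤0 ⟩
      0#        ≈⟨ -‿inverseˡ 1# ⟨
      - 1# + 1# ∎)

  fromℕ-homo-+ : ∀ m n → fromℕ (m ℕ.+ n) ≈ fromℕ m + fromℕ n
  fromℕ-homo-+ m n = ×-homo-+ 1# m n

  fromℕ-nonNegative : ∀ n → 0# ≤ fromℕ n
  fromℕ-nonNegative zero    = ≤-refl
  fromℕ-nonNegative (suc n) = begin
    0#           ≈⟨ +-identityˡ 0# ⟨
    0# + 0#      ≤⟨ +-mono-≤ 0≤1 (fromℕ-nonNegative n) ⟩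
    1# + fromℕ n ∎

  fromℕ-suc≉0 : ∀ n → fromℕ (suc n) ≈ 0# → ⊥
  fromℕ-suc≉0 n eq = 0≉1 (antisym 0≤1 (begin
    1#           ≈⟨ +-identityʳ 1# ⟨
    1# + 0#      ≤⟨ +-monoʳ-≤ 1# (fromℕ-nonNegative n) ⟩
    1# + fromℕ n ≈⟨ eq ⟩
    0#           ∎))

  *-cancelʳ-≤-fromℕ : ∀ n {x y} → x * fromℕ (suc n) ≤ y * fromℕ (suc n) → x ≤ y
  *-cancelʳ-≤-fromℕ n {x} {y} le with total x y
  ... | inj₁ x≤y = x≤y
  ... | inj₂ y≤x = +-cancelʳ-≤ (x * fromℕ n) (begin
    x + x * fromℕ n    ≈⟨ expand x (fromℕ n) ⟨
    x * fromℕ (suc n)  ≤⟨ le ⟩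
    y * fromℕ (suc n)  ≈⟨ expand y (fromℕ n) ⟩
    y + y * fromℕ n    ≤⟨ +-monoʳ-≤ y (*-monoˡ-≤ (fromℕ-nonNegative n) y≤x) ⟩
    y + x * fromℕ n    ∎)
    where
    expand : ∀ z m → z * (1# + m) ≈ z + z * m
    expand = solve 2 (λ z m → z :* (con 1 :+ m) := z :+ z :* m) ≈-refl

  -- Rearrangement inequality: the total is larger when the larger factors are
  -- paired.
  exchange : ∀ {x y m n} → x ≤ y → m ℕ.≤ n →
             x * fromℕ n + y * fromℕ m ≤ x * fromℕ m + y * fromℕ n
  exchange {x} {y} {m} {n} x≤y m≤n with d , refl ← ℕ.m≤n⇒∃[o]m+o≡n m≤n = begin
    x * fromℕ (m ℕ.+ d) + y * fromℕ m              ≈⟨ +-congʳ (*-congˡ (fromℕ-homo-+ m d)) ⟩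
    x * (fromℕ m + fromℕ d) + y * fromℕ m          ≈⟨ left x y (fromℕ m) (fromℕ d) ⟩
    (x * fromℕ m + y * fromℕ m) + x * fromℕ d      ≤⟨ +-monoʳ-≤ _ (*-monoˡ-≤ (fromℕ-nonNegative d) x≤y) ⟩
    (x * fromℕ m + y * fromℕ m) + y * fromℕ d      ≈⟨ right x y (fromℕ m) (fromℕ d) ⟩
    x * fromℕ m + y * (fromℕ m + fromℕ d)          ≈⟨ +-congˡ (*-congˡ (fromℕ-homo-+ m d)) ⟨
    x * fromℕ m + y * fromℕ (m ℕ.+ d)              ∎
    where
    left = solve 4 (λ x y m d → x :* (m :+ d) :+ y :* m := (x :* m :+ y :* m) :+ x :* d) ≈-refl
    right = solve 4 (λ x y m d → (x :* m :+ y :* m) :+ y :* d := x :* m :+ y :* (m :+ d)) ≈-refl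

  fromℤ-⊖ : ∀ m n → fromℤ (m ℤ.⊖ n) ≈ fromℕ m - fromℕ n
  fromℤ-⊖ zero    zero    = ≈-sym (-‿inverseʳ 0#)
  fromℤ-⊖ zero    (suc n) = ≈-sym (+-identityˡ _)
  fromℤ-⊖ (suc m) zero    = begin-equality
    fromℕ (suc m)              ≈⟨ x+z-z≈x _ 0# ⟨
    (fromℕ (suc m) + 0#) - 0#  ≈⟨ +-congʳ (+-identityʳ _) ⟩
    fromℕ (suc m) - 0#         ∎
  fromℤ-⊖ (suc m) (suc n) = begin-equality
    fromℤ (suc m ℤ.⊖ suc n)              ≡⟨ cong fromℤ (ℤ.[1+m]⊖[1+n]≡m⊖n m n) ⟩
    fromℤ (m ℤ.⊖ n)                      ≈⟨ fromℤ-⊖ m n ⟩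
    fromℕ m - fromℕ n                    ≈⟨ x+z-z≈x _ (fromℕ (suc n)) ⟨
    ((fromℕ m - fromℕ n) + (1# + fromℕ n)) - fromℕ (suc n)
      ≈⟨ +-congʳ (regroup (fromℕ m) (- fromℕ n) (fromℕ n)) ⟩
    ((1# + fromℕ m) + (- fromℕ n + fromℕ n)) - fromℕ (suc n)
      ≈⟨ +-congʳ (≈-trans (+-congˡ (-‿inverseˡ _)) (+-identityʳ _)) ⟩
    fromℕ (suc m) - fromℕ (suc n)        ∎
    where
    regroup : ∀ m n′ n → (m + n′) + (1# + n) ≈ (1# + m) + (n′ + n)
    regroup = solve 3 (λ m n′ n → (m :+ n′) :+ (con 1 :+ n) := (con 1 :+ m) :+ (n′ :+ n)) ≈-refl

  fromℤ-homo-+ : ∀ m z → fromℤ (+ m ℤ.+ z) ≈ fromℕ m + fromℤ z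
  fromℤ-homo-+ m (+ n)    = fromℕ-homo-+ m n
  fromℤ-homo-+ m -[1+ n ] = fromℤ-⊖ m (suc n)

  -- Combines an upper bound x ≤ Δ p + ϱ (n - p) and a lower bound
  -- y ≥ δ m + ϱ (n - m). Writing Δ = (Δ - δ) + δ and ϱ = (ϱ - δ) + δ in the sum of
  -- the two hypotheses turns it into the claim by commutative semiring identities
  -- and cancellation of a common summand.
  difference-≤ : ∀ {x y Δ δ ϱ m n p z} → m ≈ p + z →
                 x + ϱ * p ≤ Δ * p + ϱ * n →
                 δ * m + ϱ * n ≤ y + ϱ * m →
                 x - y ≤ (Δ - δ) * p + (ϱ - δ) * z
  difference-≤ {x} {y} {Δ} {δ} {ϱ} {m} {n} {p} {z} m≈p+z upper lower = +-cancelʳ-≤ y (begin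
    (x - y) + y                       ≈⟨ x-z+z≈x x y ⟩
    x                                 ≤⟨ +-cancelʳ-≤ (ϱ * p + (δ * m + ϱ * n)) step ⟩
    ((Δ - δ) * p + (ϱ - δ) * z) + y   ∎)
    where
    D = Δ - δ
    R = ϱ - δ
    D+δ = x-z+z≈x Δ δ
    R+δ = x-z+z≈x ϱ δ
    regroup : ∀ D R δ p z y q →
      ((D + δ) * p + q) + (y + (R + δ) * (p + z)) ≈
      ((D * p + R * z) + y) + ((R + δ) * p + (δ * (p + z) + q))
    regroup = solve 7 (λ D R δ p z y q →
      ((D :+ δ) :* p :+ q) :+ (y :+ (R :+ δ) :* (p :+ z)) :=
      ((D :* p :+ R :* z) :+ y) :+ ((R :+ δ) :* p :+ (δ :* (p :+ z) :+ q))) ≈-refl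
    step : x + (ϱ * p + (δ * m + ϱ * n)) ≤ ((D * p + R * z) + y) + (ϱ * p + (δ * m + ϱ * n))
    step = begin
      x + (ϱ * p + (δ * m + ϱ * n))                  ≈⟨ +-assoc _ _ _ ⟨
      (x + ϱ * p) + (δ * m + ϱ * n)                  ≤⟨ +-mono-≤ upper lower ⟩
      (Δ * p + ϱ * n) + (y + ϱ * m)
        ≈⟨ +-cong (+-congʳ (*-congʳ D+δ)) (+-congˡ (*-cong R+δ (≈-sym m≈p+z))) ⟨
      ((D + δ) * p + ϱ * n) + (y + (R + δ) * (p + z)) ≈⟨ regroup D R δ p z y (ϱ * n) ⟩
      ((D * p + R * z) + y) + ((R + δ) * p + (δ * (p + z) + ϱ * n))
        ≈⟨ +-congˡ (+-cong (*-congʳ R+δ) (+-congʳ (*-congˡ (≈-sym m≈p+z)))) ⟩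
      ((D * p + R * z) + y) + (ϱ * p + (δ * m + ϱ * n)) ∎

-- Path weights, the rate and critical paths

module Weights {c ℓ₁ ℓ₂} (ℝ : RealNumbers c ℓ₁ ℓ₂) {N : ℕ} (A : MaxPlus.Matrix ℝ N) where
  open RealNumbers ℝ
    renaming (refl to ≈-refl; sym to ≈-sym; trans to ≈-trans; reflexive to ≈-reflexive)
  open MaxPlus ℝ
  open OrderedField ℝ
  open import Relation.Binary.Reasoning.PartialOrder poset
  open import Algebra.Solver.Ring.NaturalCoefficients.Default commutativeSemiring
    using (solve; _:=_; _:+_; _:*_; con)

  private
    G : Graph N c
    G = graph A

  weight-++ : (π : Path G i j) (σ : Path G j k) → weight A (π ++ σ) ≈ weight A π + weight A σ
  weight-++ ([] _)  σ = ≈-sym (+-identityˡ _)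
  weight-++ (e ∷ π) σ = ≈-trans (+-congˡ (weight-++ π σ)) (≈-sym (+-assoc _ _ _))

  fromℕ-length-++ : (π : Path G i j) (σ : Path G j k) →
                    fromℕ (length (π ++ σ)) ≈ fromℕ (length π) + fromℕ (length σ)
  fromℕ-length-++ π σ =
    ≈-trans (≈-reflexive (cong fromℕ (length-++ π σ))) (fromℕ-homo-+ (length π) (length σ))

  weight-≤ : ∀ {Δ} → UpperBound _≤_ (EdgeWeight A) Δ →
             (π : Path G i j) → weight A π ≤ Δ * fromℕ (length π)
  weight-≤ {Δ = Δ} bound ([] _)  = ≤-reflexive (≈-sym (zeroʳ Δ))
  weight-≤ {Δ = Δ} bound (e ∷ π) = begin
    finite e + weight A π             ≤⟨ +-mono-≤ (bound (_ , _ , e , refl)) (weight-≤ bound π) ⟩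
    Δ + Δ * fromℕ (length π)          ≈⟨ solve 2 (λ x l → x :* (con 1 :+ l) := x :+ x :* l) ≈-refl Δ _ ⟨
    Δ * fromℕ (suc (length π))        ∎

  weight-≥ : ∀ {δ} → (∀ {w} → EdgeWeight A w → δ ≤ w) →
             (π : Path G i j) → δ * fromℕ (length π) ≤ weight A π
  weight-≥ {δ = δ} bound ([] _)  = ≤-reflexive (zeroʳ δ)
  weight-≥ {δ = δ} bound (e ∷ π) = begin
    δ * fromℕ (suc (length π))        ≈⟨ solve 2 (λ x l → x :* (con 1 :+ l) := x :+ x :* l) ≈-refl δ _ ⟩
    δ + δ * fromℕ (length π)          ≤⟨ +-mono-≤ (bound (_ , _ , e , refl)) (weight-≥ bound π) ⟩
    finite e + weight A π             ∎

  mean*length : (γ : Path G i i) → NonEmpty γ → mean A γ * fromℕ (length γ) ≈ weight A γ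
  mean*length ([] _)      nonEmpty = ⊥-elim (nonEmpty refl)
  mean*length γ@(_ ∷ π) _        = begin-equality
    (weight A γ * l ⁻¹) * l  ≈⟨ *-assoc _ _ _ ⟩
    weight A γ * (l ⁻¹ * l)  ≈⟨ *-congˡ (≈-trans (*-comm _ _) (⁻¹-inverseʳ (fromℕ-suc≉0 (length π)))) ⟩
    weight A γ * 1#          ≈⟨ *-identityʳ _ ⟩
    weight A γ               ∎
    where
    l = fromℕ (length γ)

  module _ {ϱ} (isRate : IsRate A ϱ) where

    -- The empty path is included, although it has no mean.
    closed-weight-≤ : (γ : Path G i i) → weight A γ ≤ ϱ * fromℕ (length γ)
    closed-weight-≤ ([] _)      = ≤-reflexive (≈-sym (zeroʳ ϱ))
    closed-weight-≤ γ@(_ ∷ _) = begin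
      weight A γ                   ≈⟨ mean*length γ (λ ()) ⟨
      mean A γ * fromℕ (length γ)  ≤⟨ *-monoˡ-≤ (fromℕ-nonNegative (length γ))
                                        (proj₁ isRate (_ , γ , (λ ()) , refl)) ⟩
      ϱ * fromℕ (length γ)         ∎

    critical-weight-≥ : (γ : Path G i i) → Critical A γ → ϱ * fromℕ (length γ) ≤ weight A γ
    critical-weight-≥ γ (nonEmpty , isRate′) = begin
      ϱ * fromℕ (length γ)         ≤⟨ *-monoˡ-≤ (fromℕ-nonNegative (length γ))
                                        (proj₂ isRate _ (proj₁ isRate′)) ⟩
      mean A γ * fromℕ (length γ)  ≈⟨ mean*length γ nonEmpty ⟩
      weight A γ                   ∎

    rate≤ : ∀ {Δ} → UpperBound _≤_ (EdgeWeight A) Δ → ϱ ≤ Δ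
    rate≤ {Δ} bound = proj₂ isRate Δ λ { (_ , γ , nonEmpty , refl) → mean≤ γ nonEmpty }
      where
      mean≤ : (γ : Path G i i) → NonEmpty γ → mean A γ ≤ Δ
      mean≤ ([] _)      nonEmpty = ⊥-elim (nonEmpty refl)
      mean≤ γ@(_ ∷ π) nonEmpty = *-cancelʳ-≤-fromℕ (length π) (begin
        mean A γ * fromℕ (length γ)  ≈⟨ mean*length γ nonEmpty ⟩
        weight A γ                   ≤⟨ weight-≤ bound γ ⟩
        Δ * fromℕ (length γ)         ∎)

    -- Some closed path is nonempty: an edge followed by a path leading back.
    ≤rate : ∀ {δ} → (∀ {w} → EdgeWeight A w → δ ≤ w) → Irreducible A → δ ≤ ϱ
    ≤rate {δ} bound (connected , (i , j , e)) = *-cancelʳ-≤-fromℕ (length π) (begin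
      δ * fromℕ (length (e ∷ π))  ≤⟨ weight-≥ bound (e ∷ π) ⟩
      weight A (e ∷ π)            ≤⟨ closed-weight-≤ (e ∷ π) ⟩
      ϱ * fromℕ (length (e ∷ π))  ∎)
      where
      π = connected _ _

    -- Every erased loop has mean weight at most ϱ, so loop erasure does not decrease
    -- the weight minus ϱ times the length.
    erasure-weight : {π′ π : Path G i j} → π′ ≼ π →
      weight A π + ϱ * fromℕ (length π′) ≤ weight A π′ + ϱ * fromℕ (length π)
    erasure-weight stop = ≤-refl
    erasure-weight (keep {e = e} {π} {π′} π′≼π) = begin
      (finite e + weight A π) + ϱ * (1# + fromℕ (length π′))   ≈⟨ regroup _ _ ϱ _ ⟩
      (finite e + ϱ) + (weight A π + ϱ * fromℕ (length π′))    ≤⟨ +-monoʳ-≤ _ (erasure-weight π′≼π) ⟩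
      (finite e + ϱ) + (weight A π′ + ϱ * fromℕ (length π))    ≈⟨ regroup _ _ ϱ _ ⟨
      (finite e + weight A π′) + ϱ * (1# + fromℕ (length π))   ∎
      where
      regroup : ∀ x w r l → (x + w) + r * (1# + l) ≈ (x + r) + (w + r * l)
      regroup = solve 4 (λ x w r l → (x :+ w) :+ r :* (con 1 :+ l) := (x :+ r) :+ (w :+ r :* l)) ≈-refl
    erasure-weight (cut {e = e} {π} α {β} αβ≼π) = +-cancelʳ-≤ (weight A α + ϱ * a) (begin
      ((finite e + weight A π) + ϱ * b) + (weight A α + ϱ * a)   ≈⟨ left (finite e) (weight A π) ϱ a b (weight A α) ⟩
      (weight A π + ϱ * (a + b)) + (finite e + weight A α)       ≈⟨ +-congʳ (+-congˡ (*-congˡ (fromℕ-length-++ α β))) ⟨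
      (weight A π + ϱ * fromℕ (length (α ++ β))) + weight A (e ∷ α)
        ≤⟨ +-mono-≤ (erasure-weight αβ≼π) (closed-weight-≤ (e ∷ α)) ⟩
      (weight A (α ++ β) + ϱ * p) + ϱ * (1# + a)                 ≈⟨ +-congʳ (+-congʳ (weight-++ α β)) ⟩
      ((weight A α + weight A β) + ϱ * p) + ϱ * (1# + a)         ≈⟨ right (weight A α) (weight A β) ϱ p a ⟩
      (weight A β + ϱ * (1# + p)) + (weight A α + ϱ * a)         ∎)
      where
      a = fromℕ (length α)
      b = fromℕ (length β)
      p = fromℕ (length π)
      left : ∀ x w r a b u → ((x + w) + r * b) + (u + r * a) ≈ (w + r * (a + b)) + (x + u)
      left = solve 6 (λ x w r a b u →
        ((x :+ w) :+ r :* b) :+ (u :+ r :* a) := (w :+ r :* (a :+ b)) :+ (x :+ u)) ≈-refl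
      right : ∀ u v r p a → ((u + v) + r * p) + r * (1# + a) ≈ (v + r * (1# + p)) + (u + r * a)
      right = solve 5 (λ u v r p a →
        ((u :+ v) :+ r :* p) :+ r :* (con 1 :+ a) := (v :+ r :* (con 1 :+ p)) :+ (u :+ r :* a)) ≈-refl

    -- A path in the critical subgraph can be returned in G so that the round trip
    -- has mean weight at least ϱ: each critical edge e lies on a critical closed
    -- path α ++ e ∷ β, and β ++ α leads back.
    retrace : (κ : Path (criticalSubgraph A) i j) →
      ∃ λ (π : Path G i j) → ∃ λ (σ : Path G j i) → length π ≡ length κ ×
      ϱ * (fromℕ (length π) + fromℕ (length σ)) ≤ weight A π + weight A σ
    retrace ([] _) = [] _ , [] _ , refl ,
      ≤-reflexive (≈-trans (*-congˡ (+-identityˡ 0#)) (≈-trans (zeroʳ ϱ) (≈-sym (+-identityˡ 0#))))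
    retrace ((_ , γ , critical , uv∈γ) ∷ κ)
      with π , σ , eq , le ← retrace κ
      with α , e , β , refl ← split-edge γ uv∈γ
      = e ∷ π , σ ++ β ++ α , cong suc eq , (begin
        ϱ * ((1# + p) + fromℕ (length (σ ++ β ++ α)))        ≈⟨ *-congˡ (+-congˡ |σβα|) ⟩
        ϱ * ((1# + p) + (s + (b + a)))                       ≈⟨ left ϱ p s b a ⟩
        ϱ * (p + s) + ϱ * (a + (1# + b))                     ≈⟨ +-congˡ (*-congˡ |γ|) ⟨
        ϱ * (p + s) + ϱ * fromℕ (length (α ++ e ∷ β))       ≤⟨ +-mono-≤ le (critical-weight-≥ (α ++ e ∷ β) critical) ⟩
        (weight A π + weight A σ) + weight A (α ++ e ∷ β)   ≈⟨ +-congˡ (weight-++ α (e ∷ β)) ⟩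
        (weight A π + weight A σ) + (weight A α + (finite e + weight A β))
          ≈⟨ right (weight A π) (weight A σ) (weight A α) (weight A β) (finite e) ⟩
        (finite e + weight A π) + (weight A σ + (weight A β + weight A α))
          ≈⟨ +-congˡ (≈-trans (weight-++ σ (β ++ α)) (+-congˡ (weight-++ β α))) ⟨
        weight A (e ∷ π) + weight A (σ ++ β ++ α)           ∎)
      where
      p = fromℕ (length π)
      s = fromℕ (length σ)
      a = fromℕ (length α)
      b = fromℕ (length β)
      |σβα| = ≈-trans (fromℕ-length-++ σ (β ++ α)) (+-congˡ (fromℕ-length-++ β α))
      |γ| = fromℕ-length-++ α (e ∷ β)
      left : ∀ r p s b a → r * ((1# + p) + (s + (b + a))) ≈ r * (p + s) + r * (a + (1# + b))
      left = solve 5 (λ r p s b a → r :* ((con 1 :+ p) :+ (s :+ (b :+ a))) :=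
        r :* (p :+ s) :+ r :* (a :+ (con 1 :+ b))) ≈-refl
      right : ∀ x y u v e → (x + y) + (u + (e + v)) ≈ (e + x) + (y + (v + u))
      right = solve 5 (λ x y u v e → (x :+ y) :+ (u :+ (e :+ v)) := (e :+ x) :+ (y :+ (v :+ u))) ≈-refl

    -- For a closed path, the return path is itself closed and so has mean weight at
    -- most ϱ; the path must make up for it.
    closed-critical : (κ : Path (criticalSubgraph A) i i) →
      ∃ λ (γ : Path G i i) → length γ ≡ length κ × ϱ * fromℕ (length γ) ≤ weight A γ
    closed-critical κ with γ , σ , eq , le ← retrace κ = γ , eq ,
      +-cancelʳ-≤ (weight A σ) (begin
        ϱ * fromℕ (length γ) + weight A σ               ≤⟨ +-monoʳ-≤ _ (closed-weight-≤ σ) ⟩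
        ϱ * fromℕ (length γ) + ϱ * fromℕ (length σ)     ≈⟨ distribˡ ϱ _ _ ⟨
        ϱ * (fromℕ (length γ) + fromℕ (length σ))       ≤⟨ le ⟩
        weight A γ + weight A σ                         ∎)

  lift-critical : (π : Path G i j) → Graph.Node (criticalSubgraph A) j →
                  (∀ {u v} → (u , v) ∈ edges π → CriticalEdge A u v) →
                  ∃ λ (π′ : Path (criticalSubgraph A) i j) → edges π′ ≡ edges π
  lift-critical ([] _)  j∈ _        = [] j∈ , refl
  lift-critical (e ∷ π) j∈ critical with π′ , eq ← lift-critical π j∈ (critical ∘ there)
    = critical (here refl) ∷ π′ , cong (_ ∷_) eq

  lift-critical-cycle : (γ : Path G i i) → Critical A γ →
                        ∃ λ (γ′ : Path (criticalSubgraph A) i i) → edges γ′ ≡ edges γ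
  lift-critical-cycle ([] _)    (nonEmpty , _) = ⊥-elim (nonEmpty refl)
  lift-critical-cycle γ@(_ ∷ _) critical       =
    lift-critical γ (_ , inj₁ (_ , γ , critical , here refl)) (λ uv∈ → _ , γ , critical , uv∈)

  -- All edges of a critical closed path are critical, so a critical closed path
  -- through r lies in the critical subgraph and can be rotated to start at r.
  critical-cycle-at : ∀ {r} → Graph.Node (criticalSubgraph A) r →
                      ∃ λ (κ : Path (criticalSubgraph A) r r) → NonEmpty κ
  critical-cycle-at (_ , inj₁ (_ , γ , critical , rv∈γ))
    with γ′ , eq ← lift-critical-cycle γ critical
    with κ , |κ| ← rotate γ′ (edge-source∈vertices γ′ (subst (_ ∈_) (sym eq) rv∈γ))
    = κ , proj₁ critical ∘ trans (trans (sym (cong List.length eq)) (sym |κ|))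
  critical-cycle-at (_ , inj₂ (_ , γ , critical , vr∈γ))
    with γ′ , eq ← lift-critical-cycle γ critical
    with κ , |κ| ← rotate γ′ (edge-target∈vertices γ′ (subst (_ ∈_) (sym eq) vr∈γ))
    = κ , proj₁ critical ∘ trans (trans (sym (cong List.length eq)) (sym |κ|))

  -- Entries of matrix powers as maximal path weights

  open NaturalMax (DecTotalOrder.totalOrder decTotalOrder) using (⊔-sel; x≤x⊔y; x≤y⊔x)

  ⊕-selective : ∀ u v {x} → u ⊕ v ≡ Infimum.[ x ] →
                (∃[ y ] u ≡ Infimum.[ y ] × x ≈ y) ⊎ (∃[ y ] v ≡ Infimum.[ y ] × x ≈ y)
  ⊕-selective ⊥₋ v eq                                 = inj₂ (_ , eq , ≈-refl)
  ⊕-selective Infimum.[ y ] ⊥₋ refl                   = inj₁ (_ , refl , ≈-refl)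
  ⊕-selective Infimum.[ y ] Infimum.[ z ] refl with ⊔-sel y z
  ... | inj₁ x≈y = inj₁ (_ , refl , x≈y)
  ... | inj₂ x≈z = inj₂ (_ , refl , x≈z)

  ⊕-upperˡ : ∀ y v → ∃[ x ] Infimum.[ y ] ⊕ v ≡ Infimum.[ x ] × y ≤ x
  ⊕-upperˡ y ⊥₋             = _ , refl , ≤-refl
  ⊕-upperˡ y Infimum.[ z ] = _ , refl , x≤x⊔y y z

  ⊕-upperʳ : ∀ u y → ∃[ x ] u ⊕ Infimum.[ y ] ≡ Infimum.[ x ] × y ≤ x
  ⊕-upperʳ ⊥₋ y             = _ , refl , ≤-refl
  ⊕-upperʳ Infimum.[ z ] y = _ , refl , x≤y⊔x z y

  ⨁-attained : ∀ {M} (f : Fin M → ℝmax) {x} → foldr _⊕_ ⊥₋ f ≡ Infimum.[ x ] →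
               ∃[ l ] ∃[ y ] f l ≡ Infimum.[ y ] × x ≈ y
  ⨁-attained {suc M} f eq with ⊕-selective (f Fin.zero) _ eq
  ... | inj₁ (y , f0≡y , x≈y) = Fin.zero , y , f0≡y , x≈y
  ... | inj₂ (y , rest≡y , x≈y) with l , z , fl≡z , y≈z ← ⨁-attained (f ∘ Fin.suc) rest≡y
    = Fin.suc l , z , fl≡z , ≈-trans x≈y y≈z

  ⨁-upper : ∀ {M} (f : Fin M → ℝmax) l {y} → f l ≡ Infimum.[ y ] →
            ∃[ x ] foldr _⊕_ ⊥₋ f ≡ Infimum.[ x ] × y ≤ x
  ⨁-upper f Fin.zero {y} f0≡y rewrite f0≡y = ⊕-upperˡ y (foldr _⊕_ ⊥₋ (f ∘ Fin.suc))
  ⨁-upper f (Fin.suc l) fl≡y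
    with z , rest≡z , y≤z ← ⨁-upper (f ∘ Fin.suc) l fl≡y
    rewrite rest≡z
    with x , eq , z≤x ← ⊕-upperʳ (f Fin.zero) z
    = x , eq , ≤-trans y≤z z≤x

  ⊙-finite⁻ : ∀ u v {x} → u ⊙ v ≡ Infimum.[ x ] →
              ∃[ y ] ∃[ z ] u ≡ Infimum.[ y ] × v ≡ Infimum.[ z ] × x ≡ y + z
  ⊙-finite⁻ Infimum.[ y ] Infimum.[ z ] refl = y , z , refl , refl , refl

  finite-unique : ∀ {u : ℝmax} (e : u ≢ ⊥₋) {x} → u ≡ Infimum.[ x ] → finite e ≡ x
  finite-unique e refl = refl

  finite-correct : ∀ {u : ℝmax} (e : u ≢ ⊥₋) → u ≡ Infimum.[ finite e ]
  finite-correct {⊥₋}            e = ⊥-elim (e refl)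
  finite-correct {Infimum.[ _ ]} e = refl

  -- An entry of a power is the maximum of the weights of the paths of that length:
  -- it is attained by power⇒path and is an upper bound by path⇒power.
  power⇒path : ∀ n {x} → (A ^⊗ n) i k ≡ Infimum.[ x ] →
               ∃ λ (π : Path G i k) → length π ≡ n × x ≈ weight A π
  power⇒path {i} {k} zero eq with i Fin.≟ k | eq
  ... | yes refl | refl = [] _ , refl , ≈-refl
  power⇒path {i} {k} (suc n) eq
    with l , y , eqₗ , x≈y ← ⨁-attained (λ l → A i l ⊙ (A ^⊗ n) l k) eq
    with a , b , Aᵢₗ≡a , Aⁿₗₖ≡b , refl ← ⊙-finite⁻ (A i l) _ eqₗ
    with π , refl , b≈w ← power⇒path n Aⁿₗₖ≡b
    = e ∷ π , refl , ≈-trans x≈y (+-cong (≈-reflexive (sym (finite-unique e Aᵢₗ≡a))) b≈w)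
    where
    e : A i l ≢ ⊥₋
    e Aᵢₗ≡⊥ with () ← trans (sym Aᵢₗ≡a) Aᵢₗ≡⊥

  path⇒power : (π : Path G i k) →
               ∃[ x ] (A ^⊗ length π) i k ≡ Infimum.[ x ] × weight A π ≤ x
  path⇒power {i} ([] _) with i Fin.≟ i
  ... | yes _  = 0# , refl , ≤-refl
  ... | no i≢i = ⊥-elim (i≢i refl)
  path⇒power {i} {k} (_∷_ {j = l} e π)
    with b , Aⁿₗₖ≡b , w≤b ← path⇒power π
    with x , eq , y≤x ← ⨁-upper (λ l → A i l ⊙ (A ^⊗ length π) l k) l
                          (cong₂ _⊙_ (finite-correct e) Aⁿₗₖ≡b)
    = x , eq , ≤-trans (+-monoʳ-≤ _ w≤b) y≤x

  -- Upper and lower bounds for path weights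

  -- Erasing loops leaves at most pred N edges, which weigh at most Δ each.
  weight-upper : ∀ {Δ ϱ} → UpperBound _≤_ (EdgeWeight A) Δ → IsRate A ϱ → (π : Path G i k) →
    weight A π + ϱ * fromℕ (ℕ.pred N) ≤ Δ * fromℕ (ℕ.pred N) + ϱ * fromℕ (length π)
  weight-upper {Δ = Δ} {ϱ} bound isRate π with π′ , π′≼π , unique ← erase-loops π =
    +-cancelʳ-≤ (ϱ * l + Δ * l) (begin
      (weight A π + ϱ * p) + (ϱ * l + Δ * l)   ≈⟨ left (weight A π) (ϱ * p) (ϱ * l) (Δ * l) ⟩
      (weight A π + ϱ * l) + (ϱ * p + Δ * l)   ≤⟨ +-mono-≤ (erasure-weight isRate π′≼π)
                                                    (exchange (rate≤ isRate bound) (ℕ.<⇒≤pred (Unique⇒length< π′ unique))) ⟩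
      (weight A π′ + ϱ * n) + (ϱ * l + Δ * p)  ≤⟨ +-mono-≤ (+-mono-≤ (weight-≤ bound π′) ≤-refl) ≤-refl ⟩
      (Δ * l + ϱ * n) + (ϱ * l + Δ * p)        ≈⟨ right (Δ * l) (ϱ * n) (ϱ * l) (Δ * p) ⟩
      (Δ * p + ϱ * n) + (ϱ * l + Δ * l)        ∎)
    where
    l = fromℕ (length π′)
    p = fromℕ (ℕ.pred N)
    n = fromℕ (length π)
    left : ∀ x y z u → (x + y) + (z + u) ≈ (x + z) + (y + u)
    left = solve 4 (λ x y z u → (x :+ y) :+ (z :+ u) := (x :+ z) :+ (y :+ u)) ≈-refl
    right : ∀ x y z u → (x + y) + (z + u) ≈ (u + y) + (z + x)
    right = solve 4 (λ x y z u → (x :+ y) :+ (z :+ u) := (u :+ y) :+ (z :+ x)) ≈-refl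

  -- If γ has mean weight at least ϱ, only the edges of α and β count at the lower
  -- rate δ. Their number may be replaced by any M above it, since δ ≤ ϱ.
  weight-lower : ∀ {δ ϱ} → (∀ {w} → EdgeWeight A w → δ ≤ w) → δ ≤ ϱ →
    (α : Path G i j) (γ : Path G j j) (β : Path G j k) → ϱ * fromℕ (length γ) ≤ weight A γ →
    ∀ {M} → length α ℕ.+ length β ℕ.≤ M →
    δ * fromℕ M + ϱ * fromℕ (length (α ++ γ ++ β)) ≤ weight A (α ++ γ ++ β) + ϱ * fromℕ M
  weight-lower {δ = δ} {ϱ} bound δ≤ϱ α γ β heavy {M} L≤M = begin
    δ * m + ϱ * fromℕ (length (α ++ γ ++ β))        ≈⟨ +-congˡ (*-congˡ |αγβ|) ⟩
    δ * m + ϱ * (a + (g + b))                       ≈⟨ left (δ * m) ϱ a g b ⟩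
    (δ * m + ϱ * (a + b)) + ϱ * g                   ≈⟨ +-congʳ (+-congˡ (*-congˡ |α|+|β|)) ⟨
    (δ * m + ϱ * fromℕ L) + ϱ * g                   ≤⟨ +-mono-≤ (exchange δ≤ϱ L≤M) heavy ⟩
    (δ * fromℕ L + ϱ * m) + weight A γ              ≈⟨ +-congʳ (+-congʳ (*-congˡ |α|+|β|)) ⟩
    (δ * (a + b) + ϱ * m) + weight A γ              ≈⟨ +-congʳ (+-congʳ (distribˡ δ a b)) ⟩
    ((δ * a + δ * b) + ϱ * m) + weight A γ
      ≤⟨ +-mono-≤ (+-mono-≤ (+-mono-≤ (weight-≥ bound α) (weight-≥ bound β)) ≤-refl) ≤-refl ⟩
    ((weight A α + weight A β) + ϱ * m) + weight A γ ≈⟨ right (weight A α) (weight A β) (ϱ * m) (weight A γ) ⟩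
    (weight A α + (weight A γ + weight A β)) + ϱ * m
      ≈⟨ +-congʳ (≈-trans (weight-++ α (γ ++ β)) (+-congˡ (weight-++ γ β))) ⟨
    weight A (α ++ γ ++ β) + ϱ * m                  ∎
    where
    a = fromℕ (length α)
    b = fromℕ (length β)
    g = fromℕ (length γ)
    m = fromℕ M
    L = length α ℕ.+ length β
    |α|+|β| : fromℕ L ≈ a + b
    |α|+|β| = fromℕ-homo-+ (length α) (length β)
    |αγβ| : fromℕ (length (α ++ γ ++ β)) ≈ a + (g + b)
    |αγβ| = ≈-trans (fromℕ-length-++ α (γ ++ β)) (+-congˡ (fromℕ-length-++ γ β))
    left : ∀ x r a g b → x + r * (a + (g + b)) ≈ (x + r * (a + b)) + r * g
    left = solve 5 (λ x r a g b → x :+ r :* (a :+ (g :+ b)) := (x :+ r :* (a :+ b)) :+ r :* g) ≈-refl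
    right : ∀ x y z u → ((x + y) + z) + u ≈ (x + (u + y)) + z
    right = solve 4 (λ x y z u → ((x :+ y) :+ z) :+ u := (x :+ (u :+ y)) :+ z) ≈-refl

  module _ {ϱ r h} (isRate : IsRate A ϱ) (r∈ : Graph.Node (criticalSubgraph A) r)
           (isCyclicity : IsCyclicity (component (criticalSubgraph A) r) h) where

    -- The cyclicity of a critical component is positive and at most N, since it
    -- divides the length of a short nonempty closed path.
    critical-cyclicity-bounded : ∃[ h′ ] h ≡ suc h′ × h′ ℕ.≤ ℕ.pred N
    critical-cyclicity-bounded
      with κ , nonEmpty ← critical-cycle-at r∈
      with κ′ , |κ′| ← into-component ([] r∈) κ ([] r∈)
      with γ , nonEmptyγ , |γ|≤N ← short-cycle κ′ (nonEmpty ∘ trans (sym |κ′|))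
      = positive (proj₁ isCyclicity (_ , γ , nonEmptyγ , refl)) nonEmptyγ |γ|≤N
      where
      positive : ∀ {d l} → d ∣ l → l ≢ 0 → l ℕ.≤ N → ∃[ d′ ] d ≡ suc d′ × d′ ℕ.≤ ℕ.pred N
      positive {zero}  d∣l l≢0 _   = ⊥-elim (l≢0 (ℕ∣.0∣⇒≡0 d∣l))
      positive {suc d} {zero}  d∣l l≢0 _   = ⊥-elim (l≢0 refl)
      positive {suc d} {suc l} d∣l _   l≤N =
        d , refl , ℕ.<⇒≤pred (ℕ.≤-trans (ℕ∣.∣⇒≤ d∣l) l≤N)

    -- Closed paths of the component have the same lengths as closed paths of G.
    cyclicity∣critical-cyclicity : ∀ {g} → IsCyclicity G g → g ∣ h
    cyclicity∣critical-cyclicity {g} isCyclicityG =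
      proj₂ isCyclicity g λ { (_ , κ , _ , refl) → divides κ }
      where
      divides : (κ : Path (component (criticalSubgraph A) r) i i) → g ∣ length κ
      divides κ
        with κ′ , |κ′| ← from-component κ
        with γ , |γ| , _ ← closed-critical isRate κ′
        = subst (g ∣_) (trans |γ| |κ′|) (cyclicity∣length isCyclicityG γ)

  -- Loop erasure gives both bounds at once. They are independent: simple paths may
  -- have length N, so cd can exceed pred N.
  short-path : ∀ {cd} → StronglyConnected G → IsCabDriverDiameter G cd → ∀ i j →
               ∃ λ (π : Path G i j) → length π ℕ.≤ ℕ.pred N × length π ℕ.≤ cd
  short-path connected (_ , maximal) i j with π , _ , unique ← erase-loops (connected {i} {j} _ _)
    = π , ℕ.<⇒≤pred (Unique⇒length< π unique) ,
      maximal (i , j , π , Unique⇒Simple π unique , refl)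

  -- The weight of some path with the same ends and length as π is at least
  -- δ M + ϱ (n - M), where n is the length of π and M = 3 (N - 1) + ep.
  heavy-walk : ∀ {δ ϱ ep B} → Irreducible A → (∀ {w} → EdgeWeight A w → δ ≤ w) → IsRate A ϱ →
    IsExplorationPenalty G ep → IsBms A B → (π : Path G i j) → B ℤ.≤ + length π →
    ∃ λ (σ : Path G i j) → length σ ≡ length π ×
    ∃[ M ] + M ≡ + ℕ.pred N ℤ.+ (+ 2 ℤ.* + ℕ.pred N ℤ.+ ep) ×
    δ * fromℕ M + ϱ * fromℕ (length σ) ≤ weight A σ + ϱ * fromℕ M
  heavy-walk {i} {j} {δ} {ϱ} {ep} {B} irreducible bound isRate
    isEp@(g , isCyclicityG , closedG , _)
    (cd , ep′ , maxC , maxEp , isCd , isEp′ , (_ , C≤maxC) ,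
      ((_ , (r , r∈ , refl) , (h , isCyclicityH , closedH , _)) , _) , B≡) π B≤n
    -- The component with maximal exploration penalty is used; its cyclicity h is
    -- below maxC by maximality of the latter.
    with refl ← penalty-unique isEp′ isEp
    with h′ , refl , h′≤p ← critical-cyclicity-bounded isRate r∈ isCyclicityH
    with α , α≤p , α≤cd ← short-path (proj₁ irreducible) isCd i r
    with β , β≤p , β≤cd ← short-path (proj₁ irreducible) isCd r j
    with t , s , t+s≡ , ep≤t , t≤ , g∣t , h∣s ←
      split-multiple (+ length π ℤ.- + length (α ++ β)) ep
        (lengths-congruent isCyclicityG (proj₁ irreducible) π (α ++ β))
        (cyclicity∣critical-cyclicity isRate r∈ isCyclicityH isCyclicityG)
    with τ , refl ← closedG {r} _ t ep≤t (Signed.∣⇒∣ᵤ g∣t)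
    with κ , refl ← closedH {r} ([] r∈ , [] r∈) s
      (remainder-≥ cd ep maxC maxEp t s (ℕ.+-mono-≤ α≤cd β≤cd) t≤
        (C≤maxC (_ , (r , r∈ , refl) , isCyclicityH))
        (trans t+s≡ (cong (λ l → + length π ℤ.- + l) (length-++ α β)))
        (subst (ℤ._≤ + length π) B≡ B≤n))
      (Signed.∣⇒∣ᵤ h∣s)
    with κ′ , |κ′| ← from-component κ
    with γ , |γ| , heavy ← closed-critical isRate κ′
    with M , M≡ , L≤M ← ℕ-between (ℕ.pred N) ep (length τ) α≤p β≤p h′≤p t≤
    = (α ++ τ) ++ γ ++ β ,
      trans (trans (length-++ (α ++ τ) (γ ++ β)) (cong₂ ℕ._+_ (length-++ α τ) (length-++ γ β)))
        (lengths-add-up (length α) (length τ) (length γ) (length β)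
          (trans (cong (λ l → + length τ ℤ.+ + l) (trans |γ| |κ′|))
            (trans t+s≡ (cong (λ l → + length π ℤ.- + l) (length-++ α β))))) ,
      M , M≡ ,
      weight-lower bound (≤rate isRate bound irreducible) (α ++ τ) γ β heavy
        (subst (ℕ._≤ M) (cong (ℕ._+ length β) (sym (length-++ α τ))) L≤M)

-- An element of Fin N witnesses that N is positive.
+[N]-1≡pred : Fin N → + N ℤ.- + 1 ≡ + ℕ.pred N
+[N]-1≡pred {suc N} _ = refl

corollary6 : ∀ {c ℓ₁ ℓ₂} (ℝ : RealNumbers c ℓ₁ ℓ₂) →
    let open RealNumbers ℝ
        open MaxPlus ℝ
    in
    ∀ {N : ℕ} (A : Matrix N) → Irreducible A →
    ∀ {Δ δ ϱ : Carrier} {ep : ℤ} {μ : Carrier ±} →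
    IsMaxWeight A Δ → IsMinWeight A δ → IsRate A ϱ → IsExplorationPenalty (graph A) ep → Isμ A μ →
    μ ≤± [ (Δ - δ) * fromℤ (+ N ℤ.- + 1)
           + (ϱ - δ) * fromℤ (+ 2 ℤ.* (+ N ℤ.- + 1) ℤ.+ ep) ]
corollary6 ℝ {N} A irreducible {Δ} {δ} {ϱ} {ep} (_ , ≤Δ) (_ , δ≤) isRate isEp (B , isBms , _ , least) =
  least _ λ { (i , j , k , n , B≤n , f , refl) → bounded i j k n B≤n f }
  where
  open RealNumbers ℝ hiding (refl; sym; trans)
  open RealNumbers ℝ using () renaming (trans to ≈-trans; reflexive to ≈-reflexive)
  open MaxPlus ℝ
  open OrderedField ℝ
  open Weights ℝ A

  bound : Carrier
  bound = (Δ - δ) * fromℤ (+ N ℤ.- + 1) + (ϱ - δ) * fromℤ (+ 2 ℤ.* (+ N ℤ.- + 1) ℤ.+ ep)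

  entry-difference : ∀ i j k n {x y} → B ℤ.≤ + n →
    (A ^⊗ n) i k ≡ Infimum.[ x ] → (A ^⊗ n) i j ≡ Infimum.[ y ] → x - y ≤ bound
  entry-difference i j k n {x} {y} B≤n Aᵢₖ≡x Aᵢⱼ≡y
    with π , refl , x≈w ← power⇒path n Aᵢₖ≡x
    with π₀ , |π₀| , _ ← power⇒path n Aᵢⱼ≡y
    with σ , |σ| , M , M≡ , lower ←
      heavy-walk irreducible δ≤ isRate isEp isBms π₀ (subst (λ l → B ℤ.≤ + l) (sym |π₀|) B≤n)
    with y′ , Aᵢⱼ≡y′ , w≤y′ ← path⇒power σ
    rewrite trans |σ| |π₀|
    with refl ← trans (sym Aᵢⱼ≡y) Aᵢⱼ≡y′
    rewrite +[N]-1≡pred i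
    = difference-≤ {n = fromℕ n}
        (≈-trans (≈-reflexive (cong fromℤ M≡)) (fromℤ-homo-+ (ℕ.pred N) (+ 2 ℤ.* + ℕ.pred N ℤ.+ ep)))
        (≤-trans (+-mono-≤ (≤-reflexive x≈w) ≤-refl) (weight-upper ≤Δ isRate π))
        (≤-trans lower (+-mono-≤ w≤y′ ≤-refl))

  bounded : ∀ i j k n → B ℤ.≤ + n → (f : (A ^⊗ n) i j ≢ ⊥₋) →
            Supremum.[ (A ^⊗ n) i k ⊖ finite f ] ≤± [ bound ]
  bounded i j k n B≤n f with (A ^⊗ n) i k in Aᵢₖ≡x
  ... | ⊥₋             = Supremum≤.[ Infimum≤.⊥₋≤ _ ]
  ... | Infimum.[ x ] = Supremum≤.[ Infimum≤.[ entry-difference i j k n B≤n Aᵢₖ≡x (finite-correct f) ] ]
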